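{- In Version C, the $\mathcal{P}$-positions with $3$, $4$, or $5$ piles are precisely the following, where the piles are listed in nondecreasing order. \begin{itemize} \item For $3$ piles: the positions in $\langle e,e,e\rangle$ and $\langle o,o,o\rangle$. \item For $4$ piles: the positions in $\langle e,e,e,e\rangle$ and $\langle e,o,o,o\rangle$. \item For $5$ piles: the positions in $\langle e,e,e,e,e\rangle$, $\langle e,e,o,o,o\rangle$, $\langle o,o,e,e,o\rangle$, and $\langle o,o,o,o,e\rangle$. \end{itemize}
   Context: Version C is a two-player impartial game. A position consists of finitely many piles of tokens, with sizes nonnegative integers. The players alternate turns; on a turn, a player either removes a single token from any one nonempty pile, or selects two different nonempty piles and removes one token from each of those two. The last player to move wins. A position is a $\mathcal{P}$-position if the player who is not about to move has a winning strategy, equivalently if none of its options (positions reachable in one move) is a $\mathcal{P}$-position; otherwise it is an $\mathcal{N}$-position. Notation: for $x_1,\dots,x_n\in\{e,o\}$, $\langle x_1,x_2,\ldots,x_n\rangle$ denotes the set of all positions $a_1,a_2,\ldots,a_n$ with $a_1\leq a_2\leq\cdots\leq a_n$ such that, for every $1\leq i\leq n$, $x_i$ is the parity of $a_i$ ($e$ for even, $o$ for odd). -}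

module Defs where

open import Data.Fin.Base using (Fin)
open import Data.List.Relation.Binary.Permutation.Propositional using (_↭_)
open import Data.Nat.Base using (ℕ; pred; parity; _≤_; _<_)
open import Data.Parity.Base public using (Parity) renaming (0ℙ to e; 1ℙ to o)
open import Data.Product.Base using (_×_; ∃-syntax)
open import Data.Vec.Base using (Vec; lookup; map; toList; updateAt)
open import Data.Vec.Relation.Unary.Linked using (Linked)
open import Level using (0ℓ)
open import Relation.Binary.PropositionalEquality.Core using (_≡_; _≢_)
open import Relation.Unary using (Pred)

-- Piles are stored in an arbitrary order, since a move need not keep them
-- sorted, and empty piles are kept, so a move preserves the number of piles.
Position : ℕ → Set
Position n = Vec ℕ n

infix 4 _⟶_

data _⟶_ {n : ℕ} (a : Position n) : Position n → Set where
  take-one : (i : Fin n) → 0 < lookup a i →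
             a ⟶ updateAt a i pred
  take-two : (i j : Fin n) → i ≢ j → 0 < lookup a i → 0 < lookup a j →
             a ⟶ updateAt (updateAt a i pred) j pred

-- Elements of 𝒫 a (resp. NextWins a) are winning strategies for the player
-- who is not (resp. who is) about to move.  With no option available the
-- player about to move loses, as the last player to move wins.
mutual
  data 𝒫 {n : ℕ} (a : Position n) : Set where
    reply : (∀ {b} → a ⟶ b → NextWins b) → 𝒫 a

  data NextWins {n : ℕ} (a : Position n) : Set where
    move : ∀ {b} → a ⟶ b → 𝒫 b → NextWins a

-- The vector b lists the piles of a in nondecreasing order.
⟨_⟩ : ∀ {n} → Vec Parity n → Pred (Position n) 0ℓ
⟨_⟩ {n} x a = ∃[ b ] toList {n = n} b ↭ toList a × Linked _≤_ b × map parity b ≡ x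

{-# OPTIONS --safe #-}
-- Write s(a) for the parities of the sorted position a.  Sorting is monotone
-- and commutes with adding one to every pile, so a move that takes k tokens
-- changes s(a) in exactly k places.  In each of the three cases the listed
-- parity vectors form a code of minimum distance 3, so no move leads from one
-- of them to another.  Conversely, every vector x off the code is turned into
-- a codeword by changing one or two entries, each of which differs from the
-- entry before it or follows a changed one (an entry e preceding the vector
-- stands for a pile of size 0).  Such entries can be decremented in any
-- position with sorted parities x, whatever its ties, and leave it sorted.
module Submission where

open import Defs
open import Algebra.Properties.CommutativeSemigroup using (interchange; x∙yz≈y∙xz)
open import Data.Bool.Base using (if_then_else_)
open import Data.Fin.Base using (Fin; zero; suc)
open import Data.List.Base using (List; []; _∷_)
open import Data.List.Membership.Propositional using (_∈_; find)
open import Data.List.Relation.Binary.Permutation.Propositional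
  using (_↭_; refl; prep; swap; ↭-sym; ↭⇒↭ₛ) renaming (trans to trans-↭)
open import Data.List.Relation.Binary.Pointwise using (Pointwise-≡⇒≡)
open import Data.List.Relation.Unary.All as All using (All)
open import Data.List.Relation.Unary.Any using (Any; any?; here; there)
open import Data.List.Relation.Unary.Linked as ListLinked using ([]; [-]; _∷_)
open import Data.List.Relation.Unary.Sorted.TotalOrder.Properties using (↗↭↗⇒≋)
open import Data.Nat.Base
open import Data.Nat.Induction using (Acc; acc; <-wellFounded)
open import Data.Nat.ListAction using (sum)
open import Data.Nat.ListAction.Properties using (sum-↭)
open import Data.Nat.Properties hiding (_≟_)
open import Data.Parity.Properties using (_≟_)
open import Data.Product.Base using (_×_; _,_; proj₁; proj₂; ∃-syntax)
open import Data.Sum.Base using (_⊎_; inj₁; inj₂)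
open import Data.Vec.Base using (Vec; []; _∷_; lookup; map; toList; updateAt; zip)
open import Data.Vec.Properties using (≡-dec; toList-injective; cast-is-id)
open import Data.Vec.Relation.Binary.Pointwise.Inductive using (Pointwise; []; _∷_)
open import Data.Vec.Relation.Unary.Linked as Linked using (Linked; []; [-]; _∷_; linked?)
open import Function.Base using (_∘_)
open import Level using (0ℓ)
open import Relation.Binary.PropositionalEquality
open import Relation.Nullary
open import Relation.Nullary.Decidable
  using (from-yes; decidable-stable; _×-dec_; _⊎-dec_; _→-dec_; map′)
open import Relation.Unary using (Pred; Decidable; _≐_; _∪_)

private
  variable
    k m n x y x′ y′ : ℕ
    xs ys xs′ : List ℕ

-- Moves as token counts

-- Matched list positions take the place of pile indices: moves become the cases `k` equal to 1 and
-- 2, and can be carried along permutations by induction.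
data Drop : ℕ → List ℕ → List ℕ → Set where
  []   : Drop 0 [] []
  keep : Drop k xs ys → Drop k (x ∷ xs) (x ∷ ys)
  take : Drop k xs ys → Drop (suc k) (suc x ∷ xs) (x ∷ ys)

OneOrTwo : ℕ → Set
OneOrTwo k = 1 ≤ k × k ≤ 2

Drop-refl : ∀ xs → Drop 0 xs xs
Drop-refl []       = []
Drop-refl (x ∷ xs) = keep (Drop-refl xs)

Drop-sum : Drop k xs ys → sum xs ≡ k + sum ys
Drop-sum [] = refl
Drop-sum {k} {x ∷ xs} {x ∷ ys} (keep d) = begin
  x + sum xs       ≡⟨ cong (x +_) (Drop-sum d) ⟩
  x + (k + sum ys) ≡⟨ x∙yz≈y∙xz +-commutativeSemigroup x k (sum ys) ⟩
  k + (x + sum ys) ∎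
  where open ≡-Reasoning
Drop-sum {suc k} {suc x ∷ xs} {x ∷ ys} (take d) = cong suc (Drop-sum {k} (keep d))

-- Carries a move found on the sorted piles back to the piles in their given order.
Drop-↭ : Drop k xs ys → xs ↭ xs′ → ∃[ ys′ ] ys ↭ ys′ × Drop k xs′ ys′
Drop-↭ d refl = _ , refl , d
Drop-↭ (keep d) (prep x p) with Drop-↭ d p
... | _ , q , d′ = _ , prep _ q , keep d′
Drop-↭ (take d) (prep x p) with Drop-↭ d p
... | _ , q , d′ = _ , prep _ q , take d′
Drop-↭ (keep (keep d)) (swap x y p) with Drop-↭ d p
... | _ , q , d′ = _ , swap _ _ q , keep (keep d′)
Drop-↭ (keep (take d)) (swap x y p) with Drop-↭ d p
... | _ , q , d′ = _ , swap _ _ q , take (keep d′)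
Drop-↭ (take (keep d)) (swap x y p) with Drop-↭ d p
... | _ , q , d′ = _ , swap _ _ q , keep (take d′)
Drop-↭ (take (take d)) (swap x y p) with Drop-↭ d p
... | _ , q , d′ = _ , swap _ _ q , take (take d′)
Drop-↭ d (trans-↭ p p′) with Drop-↭ d p
... | _ , q , d′ with Drop-↭ d′ p′
... | _ , q′ , d″ = _ , trans-↭ q q′ , d″

take-one⇒Drop : (a : Position n) (i : Fin n) → 0 < lookup a i →
                Drop 1 (toList a) (toList (updateAt a i pred))
take-one⇒Drop (suc x ∷ a) zero    _   = take (Drop-refl (toList a))
take-one⇒Drop (x ∷ a)     (suc i) 0<a = keep (take-one⇒Drop a i 0<a)

take-two⇒Drop : (a : Position n) (i j : Fin n) → i ≢ j →
                0 < lookup a i → 0 < lookup a j →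
                Drop 2 (toList a) (toList (updateAt (updateAt a i pred) j pred))
take-two⇒Drop (x ∷ a)     zero    zero    i≢j _   _   = contradiction refl i≢j
take-two⇒Drop (suc x ∷ a) zero    (suc j) _   _   0<b = take (take-one⇒Drop a j 0<b)
take-two⇒Drop (suc x ∷ a) (suc i) zero    _   0<a _   = take (take-one⇒Drop a i 0<a)
take-two⇒Drop (x ∷ a)     (suc i) (suc j) i≢j 0<a 0<b =
  keep (take-two⇒Drop a i j (i≢j ∘ cong suc) 0<a 0<b)

⟶⇒Drop : {a c : Position n} → a ⟶ c → ∃[ k ] OneOrTwo k × Drop k (toList a) (toList c)
⟶⇒Drop (take-one i 0<a)           = 1 , (≤-refl , s≤s z≤n) , take-one⇒Drop _ i 0<a
⟶⇒Drop (take-two i j i≢j 0<a 0<b) = 2 , (s≤s z≤n , ≤-refl) , take-two⇒Drop _ i j i≢j 0<a 0<b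

Drop₀⇒≡ : Drop 0 xs ys → xs ≡ ys
Drop₀⇒≡ []       = refl
Drop₀⇒≡ (keep d) = cong (_ ∷_) (Drop₀⇒≡ d)

Drop₁⇒take-one : (a : Position n) → Drop 1 (toList a) ys →
                 ∃[ i ] 0 < lookup a i × toList (updateAt a i pred) ≡ ys
Drop₁⇒take-one (x ∷ a) (keep d) with Drop₁⇒take-one a d
... | i , 0<a , eq = suc i , 0<a , cong (x ∷_) eq
Drop₁⇒take-one (suc x ∷ a) (take d) = zero , z<s , cong (x ∷_) (Drop₀⇒≡ d)

Drop₂⇒take-two : (a : Position n) → Drop 2 (toList a) ys →
                 ∃[ i ] ∃[ j ] i ≢ j × 0 < lookup a i × 0 < lookup a j ×
                   toList (updateAt (updateAt a i pred) j pred) ≡ ys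
Drop₂⇒take-two (x ∷ a) (keep d) with Drop₂⇒take-two a d
... | i , j , i≢j , 0<a , 0<b , eq =
  suc i , suc j , (λ { refl → i≢j refl }) , 0<a , 0<b , cong (x ∷_) eq
Drop₂⇒take-two (suc x ∷ a) (take d) with Drop₁⇒take-one a d
... | j , 0<a , eq = zero , suc j , (λ ()) , z<s , 0<a , cong (x ∷_) eq

Drop⇒⟶ : (a : Position n) → OneOrTwo k → Drop k (toList a) ys →
         ∃[ c ] a ⟶ c × toList c ≡ ys
Drop⇒⟶ {k = 1} a _ d with Drop₁⇒take-one a d
... | i , 0<a , eq = _ , take-one i 0<a , eq
Drop⇒⟶ {k = 2} a _ d with Drop₂⇒take-two a d
... | i , j , i≢j , 0<a , 0<b , eq = _ , take-two i j i≢j 0<a 0<b , eq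
Drop⇒⟶ {k = suc (suc (suc _))} a (_ , s≤s (s≤s ())) d

-- Sorting

-- Comparing by minimum and maximum makes monotonicity immediate.
insert : ℕ → Vec ℕ n → Vec ℕ (suc n)
insert x []       = x ∷ []
insert x (y ∷ ys) = x ⊓ y ∷ insert (x ⊔ y) ys

sort : Vec ℕ n → Vec ℕ n
sort []       = []
sort (x ∷ xs) = insert x (sort xs)

⊓⊔-↭ : ∀ x y → x ⊓ y ∷ x ⊔ y ∷ xs ↭ x ∷ y ∷ xs
⊓⊔-↭ x y with ≤-total x y
... | inj₁ x≤y rewrite m≤n⇒m⊓n≡m x≤y | m≤n⇒m⊔n≡n x≤y = refl
... | inj₂ y≤x rewrite m≥n⇒m⊓n≡n y≤x | m≥n⇒m⊔n≡m y≤x = swap _ _ refl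

insert-↭ : ∀ x (b : Vec ℕ n) → toList (insert x b) ↭ x ∷ toList b
insert-↭ x []      = refl
insert-↭ x (y ∷ b) = trans-↭ (prep _ (insert-↭ (x ⊔ y) b)) (⊓⊔-↭ x y)

sort-↭ : (a : Vec ℕ n) → toList (sort a) ↭ toList a
sort-↭ []      = refl
sort-↭ (x ∷ a) = trans-↭ (insert-↭ x (sort a)) (prep x (sort-↭ a))

↗-lower-head : {b : Vec ℕ n} → x ≤ y → Linked _≤_ (y ∷ b) → Linked _≤_ (x ∷ b)
↗-lower-head x≤y [-]       = [-]
↗-lower-head x≤y (y≤z ∷ l) = ≤-trans x≤y y≤z ∷ l

-- The bound `m` makes the induction go through: `x ⊓ y`, just placed, bounds the carried `x ⊔ y`
-- and the remaining tail from below.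
insert-↗ : {b : Vec ℕ n} → m ≤ x → Linked _≤_ (m ∷ b) → Linked _≤_ (m ∷ insert x b)
insert-↗ m≤x [-] = m≤x ∷ [-]
insert-↗ {x = x} {b = y ∷ _} m≤x (m≤y ∷ l) =
  ⊓-glb m≤x m≤y ∷ insert-↗ (m⊓n≤m⊔n x y) (↗-lower-head (m⊓n≤n x y) l)

sort-↗ : (a : Vec ℕ n) → Linked _≤_ (0 ∷ sort a)
sort-↗ []      = [-]
sort-↗ (x ∷ a) = insert-↗ z≤n (sort-↗ a)

toList-↗ : {b : Vec ℕ n} → Linked _≤_ b → ListLinked.Linked _≤_ (toList b)
toList-↗ []              = []
toList-↗ [-]             = [-]
toList-↗ {b = _ ∷ _ ∷ _} (x≤y ∷ l) = x≤y ∷ toList-↗ l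

-- Allows the sorted witness inside `⟨_⟩` to be replaced by the function `sort`.
sort-unique : (a : Vec ℕ n) {b : Vec ℕ n} → Linked _≤_ b → toList b ↭ toList a → b ≡ sort a
sort-unique a {b} b↗ b↭a = trans (sym (cast-is-id refl b)) (toList-injective refl b (sort a)
  (Pointwise-≡⇒≡ (↗↭↗⇒≋ ≤-totalOrder (toList-↗ b↗) (toList-↗ (Linked.tail (sort-↗ a)))
    (↭⇒↭ₛ (trans-↭ b↭a (↭-sym (sort-↭ a)))))))

infix 4 _↘_

-- Two inequalities rather than a disjunction, since `⊓` and `⊔` preserve each of them.
_↘_ : ℕ → ℕ → Set
x ↘ y = y ≤ x × x ≤ suc y

insert-↘ : {b c : Vec ℕ n} → x ↘ y → Pointwise _↘_ b c → Pointwise _↘_ (insert x b) (insert y c)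
insert-↘ x↘y [] = x↘y ∷ []
insert-↘ (y≤x , x≤1+y) ((y′≤x′ , x′≤1+y′) ∷ b↘c) =
  (⊓-mono-≤ y≤x y′≤x′ , ⊓-mono-≤ x≤1+y x′≤1+y′) ∷
  insert-↘ (⊔-mono-≤ y≤x y′≤x′ , ⊔-mono-≤ x≤1+y x′≤1+y′) b↘c

sort-↘ : {a c : Vec ℕ n} → Pointwise _↘_ a c → Pointwise _↘_ (sort a) (sort c)
sort-↘ []          = []
sort-↘ (x↘y ∷ a↘c) = insert-↘ x↘y (sort-↘ a↘c)

Drop⇒↘ : {a c : Vec ℕ n} → Drop k (toList a) (toList c) → Pointwise _↘_ a c
Drop⇒↘ {a = []}    {[]}    []       = []
Drop⇒↘ {a = _ ∷ _} {_ ∷ _} (keep d) = (≤-refl , n≤1+n _) ∷ Drop⇒↘ d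
Drop⇒↘ {a = _ ∷ _} {_ ∷ _} (take d) = (n≤1+n _ , ≤-refl) ∷ Drop⇒↘ d

-- Parity vectors

δ : Parity → Parity → ℕ
δ p q = if does (p ≟ q) then 0 else 1

-- This is the Hamming distance.
distance : Vec Parity n → Vec Parity n → ℕ
distance []       []       = 0
distance (p ∷ ps) (q ∷ qs) = δ p q + distance ps qs

δ-refl : ∀ p → δ p p ≡ 0
δ-refl e = refl
δ-refl o = refl

δ-suc : ∀ n → δ (parity (suc n)) (parity n) ≡ 1
δ-suc 0             = refl
δ-suc 1             = refl
δ-suc (suc (suc n)) = δ-suc n

-- A difference of 0 or 1 can be read off from the two parities.
↘-δ : x ↘ y → x ≡ δ (parity x) (parity y) + y
↘-δ {x} {y} (y≤x , x≤1+y) with m≤n⇒m<n∨m≡n x≤1+y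
... | inj₂ refl rewrite δ-suc y = refl
... | inj₁ x<1+y with ≤-antisym y≤x (s≤s⁻¹ x<1+y)
...   | refl rewrite δ-refl (parity y) = refl

↘-distance : {b c : Vec ℕ n} → Pointwise _↘_ b c →
             sum (toList b) ≡ distance (map parity b) (map parity c) + sum (toList c)
↘-distance [] = refl
↘-distance {b = x ∷ b} {y ∷ c} (x↘y ∷ b↘c) =
  trans (cong₂ _+_ (↘-δ x↘y) (↘-distance b↘c))
    (interchange +-commutativeSemigroup (δ (parity x) (parity y)) y _ _)

shape : Position n → Vec Parity n
shape a = map parity (sort a)

⟨⟩⇒shape : {x : Vec Parity n} {a : Position n} → ⟨ x ⟩ a → shape a ≡ x
⟨⟩⇒shape {a = a} (b , b↭a , b↗ , refl) = cong (map parity) (sym (sort-unique a b↗ b↭a))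

shape⇒⟨⟩ : {x : Vec Parity n} {a : Position n} → shape a ≡ x → ⟨ x ⟩ a
shape⇒⟨⟩ {a = a} eq = sort a , sort-↭ a , Linked.tail (sort-↗ a) , eq

-- Sorting changes no sum and preserves `↘`, so the distance between the shapes is the number `k` of
-- tokens taken.
⟶-distance : {a c : Position n} → a ⟶ c → OneOrTwo (distance (shape a) (shape c))
⟶-distance {a = a} {c} a⟶c with ⟶⇒Drop a⟶c
... | k , k∈1‥2 , d = subst OneOrTwo (+-cancelʳ-≡ (sum (toList (sort c))) k _ eq) k∈1‥2
  where
  open ≡-Reasoning
  eq : k + sum (toList (sort c)) ≡ distance (shape a) (shape c) + sum (toList (sort c))
  eq = begin
    k + sum (toList (sort c)) ≡⟨ cong (k +_) (sum-↭ (sort-↭ c)) ⟩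
    k + sum (toList c)        ≡⟨ Drop-sum d ⟨
    sum (toList a)            ≡⟨ sum-↭ (sort-↭ a) ⟨
    sum (toList (sort a))     ≡⟨ ↘-distance (sort-↘ (Drop⇒↘ d)) ⟩
    distance (shape a) (shape c) + sum (toList (sort c)) ∎

-- Consecutive entries p, p′ become q, q′: if p′ alone changes, then p ≢ p′,
-- so the two piles are not tied.
infix 4 _⊳_

_⊳_ : Parity × Parity → Parity × Parity → Set
(p , q) ⊳ (p′ , q′) = p ≡ q → p ≡ p′ → p′ ≡ q′

-- The leading pair `(e , e)` is an untouched pile of size 0; it forbids changing a first entry `e`,
-- whose pile may be empty.
Free : Vec Parity n → Vec Parity n → Set
Free x y = Linked _⊳_ ((e , e) ∷ zip x y)

_⊳?_ : ∀ r s → Dec (r ⊳ s)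
(p , q) ⊳? (p′ , q′) = p ≟ q →-dec p ≟ p′ →-dec p′ ≟ q′

≢-parity-suc : ∀ n {p} → parity (suc n) ≢ p → parity n ≡ p
≢-parity-suc 0             {e} _  = refl
≢-parity-suc 0             {o} ≢p = contradiction refl ≢p
≢-parity-suc 1             {e} ≢p = contradiction refl ≢p
≢-parity-suc 1             {o} _  = refl
≢-parity-suc (suc (suc n)) ≢p = ≢-parity-suc n ≢p

-- If `m′` were equal to `x`, then `m` would be squeezed in between: an untouched predecessor tied
-- with `x`, after which `⊳` allows no change.
untied : ∀ {m′ q} → m′ ≤ m → m ≤ x → (parity m , parity m′) ⊳ (parity x , q) →
         parity x ≢ q → m′ < x
untied {m = m} {x} {m′} m′≤m m≤x m⊳x x≢q = ≤∧≢⇒< (≤-trans m′≤m m≤x) m′≢x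
  where
  m′≢x : m′ ≢ x
  m′≢x refl with refl ← ≤-antisym m′≤m m≤x = x≢q (m⊳x refl refl)

-- Works from left to right, with `m` and `m′` the preceding pile before and after the move. Each
-- pile whose parity must change loses one token.
Free⇒Drop : (b : Vec ℕ n) (y : Vec Parity n) {m m′ : ℕ} → m′ ≤ m → Linked _≤_ (m ∷ b) →
            Linked _⊳_ ((parity m , parity m′) ∷ zip (map parity b) y) →
            ∃[ c ] Linked _≤_ (m′ ∷ c) × map parity c ≡ y ×
              Drop (distance (map parity b) y) (toList b) (toList c)
Free⇒Drop []      []      _    _         _          = [] , [-] , refl , []
Free⇒Drop (x ∷ b) (q ∷ y) m′≤m (m≤x ∷ b↗) (m⊳x ∷ free) with parity x ≟ q
... | yes refl with c , c↗ , refl , d ← Free⇒Drop b y ≤-refl b↗ free =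
  x ∷ c , ≤-trans m′≤m m≤x ∷ c↗ , refl , keep d
-- From `m′ < x` the pile is nonempty, and it is still at least `m′` after losing a token.
... | no x≢q with s≤s {n = z} m′≤z ← untied m′≤m m≤x m⊳x x≢q
             with refl ← ≢-parity-suc z x≢q
             with c , c↗ , refl , d ← Free⇒Drop b y (n≤1+n z) b↗ free =
  z ∷ c , m′≤z ∷ c↗ , refl , take d

Free⇒⟶ : (a : Position n) (y : Vec Parity n) → Free (shape a) y →
         OneOrTwo (distance (shape a) y) → ∃[ c ] a ⟶ c × shape c ≡ y
Free⇒⟶ a y free 1‥2 with Free⇒Drop (sort a) y z≤n (sort-↗ a) free
... | b , b↗ , refl , d with Drop-↭ d (sort-↭ a)
... | _ , b↭c , d′ with Drop⇒⟶ a 1‥2 d′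
... | c , a⟶c , refl =
  c , a⟶c , cong (map parity) (sym (sort-unique c (Linked.tail b↗) b↭c))

-- Codes

-- Equal vectors are at distance 0 and pass; for distinct ones the condition means distance at least
-- 3.
Separated : List (Vec Parity n) → Set
Separated C = All (λ x → All (λ y → ¬ OneOrTwo (distance x y)) C) C

Absorbing : List (Vec Parity n) → Set
Absorbing {n} C = ∀ (x : Vec Parity n) → x ∈ C ⊎
  Any (λ y → Free x y × OneOrTwo (distance x y)) C

oneOrTwo? : Decidable OneOrTwo
oneOrTwo? k = 1 ≤? k ×-dec k ≤? 2

separated? : Decidable (Separated {n})
separated? C = All.all? (λ x → All.all? (λ y → ¬? (oneOrTwo? (distance x y))) C) C

-- Branching on the first entry exhausts the finitely many vectors, so that the covering condition
-- can be checked by computation.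
∀-dec : {P : Pred (Vec Parity n) 0ℓ} → Decidable P → Dec (∀ x → P x)
∀-dec {zero}  P? = map′ (λ { p [] → p }) (λ p → p []) (P? [])
∀-dec {suc n} P? = map′
  (λ { (pe , po) (e ∷ x) → pe x ; (pe , po) (o ∷ x) → po x })
  (λ p → p ∘ (e ∷_) , p ∘ (o ∷_))
  (∀-dec (P? ∘ (e ∷_)) ×-dec ∀-dec (P? ∘ (o ∷_)))

absorbing? : Decidable (Absorbing {n})
absorbing? C = ∀-dec λ x → any? (≡-dec _≟_ x) C ⊎-dec
  any? (λ y → linked? _⊳?_ ((e , e) ∷ zip x y) ×-dec oneOrTwo? (distance x y)) C

-- Winning strategies from a code

𝒫⇒¬NextWins : {a : Position n} → 𝒫 a → ¬ NextWins a
𝒫⇒¬NextWins (reply f) (move a⟶c c∈𝒫) = 𝒫⇒¬NextWins c∈𝒫 (f a⟶c)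

⟶-sum : {a c : Position n} → a ⟶ c → sum (toList c) < sum (toList a)
⟶-sum {c = c} a⟶c with ⟶⇒Drop a⟶c
... | k , (1≤k , _) , d rewrite Drop-sum d = +-monoˡ-≤ (sum (toList c)) 1≤k

module _ (C : List (Vec Parity n)) (separated : Separated C) (absorbing : Absorbing C) where

  -- One induction on the number of tokens proves both implications, as each of them calls on the
  -- other after a move.
  outcome : (a : Position n) → Acc _<_ (sum (toList a)) →
            (shape a ∈ C → 𝒫 a) × (¬ shape a ∈ C → NextWins a)
  outcome a (acc rec) = win , lose
    where
    win : shape a ∈ C → 𝒫 a
    win a∈C = reply λ a⟶c → proj₂ (outcome _ (rec (⟶-sum a⟶c))) λ c∈C →
      All.lookup (All.lookup separated a∈C) c∈C (⟶-distance a⟶c)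

    lose : ¬ shape a ∈ C → NextWins a
    lose a∉C with absorbing (shape a)
    ... | inj₁ a∈C = contradiction a∈C a∉C
    ... | inj₂ any with find any
    ...   | y , y∈C , free , 1‥2 with Free⇒⟶ a y free 1‥2
    ...     | c , a⟶c , refl = move a⟶c (proj₁ (outcome c (rec (⟶-sum a⟶c))) y∈C)

  shape∈⇒𝒫 : {a : Position n} → shape a ∈ C → 𝒫 a
  shape∈⇒𝒫 {a} = proj₁ (outcome a (<-wellFounded _))

  𝒫⇒shape∈ : {a : Position n} → 𝒫 a → shape a ∈ C
  𝒫⇒shape∈ {a} a∈𝒫 = decidable-stable (any? (≡-dec _≟_ (shape a)) C)
    (𝒫⇒¬NextWins a∈𝒫 ∘ proj₂ (outcome a (<-wellFounded _)))

-- The first vector is kept apart so that the union unfolds exactly to the one in the theorem,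
-- without a trailing empty set.
⋃ : Vec Parity n → List (Vec Parity n) → Pred (Position n) 0ℓ
⋃ x []      = ⟨ x ⟩
⋃ x (y ∷ C) = ⟨ x ⟩ ∪ ⋃ y C

shape∈⇒⋃ : ∀ x (C : List (Vec Parity n)) {a} → shape a ∈ x ∷ C → ⋃ x C a
shape∈⇒⋃ x []      (here eq) = shape⇒⟨⟩ eq
shape∈⇒⋃ x (y ∷ C) (here eq) = inj₁ (shape⇒⟨⟩ eq)
shape∈⇒⋃ x (y ∷ C) (there ∈C) = inj₂ (shape∈⇒⋃ y C ∈C)

⋃⇒shape∈ : ∀ x (C : List (Vec Parity n)) {a} → ⋃ x C a → shape a ∈ x ∷ C
⋃⇒shape∈ x []      a∈        = here (⟨⟩⇒shape a∈)
⋃⇒shape∈ x (y ∷ C) (inj₁ a∈) = here (⟨⟩⇒shape a∈)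
⋃⇒shape∈ x (y ∷ C) (inj₂ a∈) = there (⋃⇒shape∈ y C a∈)

𝒫≐⋃ : ∀ x (C : List (Vec Parity n)) → Separated (x ∷ C) → Absorbing (x ∷ C) →
      𝒫 ≐ ⋃ x C
𝒫≐⋃ x C sep abs =
  (λ a∈𝒫 → shape∈⇒⋃ x C (𝒫⇒shape∈ (x ∷ C) sep abs a∈𝒫)) ,
  (λ a∈ → shape∈⇒𝒫 (x ∷ C) sep abs (⋃⇒shape∈ x C a∈))

lemma3p1 : (𝒫 {3} ≐ ⟨ e ∷ e ∷ e ∷ [] ⟩ ∪ ⟨ o ∷ o ∷ o ∷ [] ⟩)
    × (𝒫 {4} ≐ ⟨ e ∷ e ∷ e ∷ e ∷ [] ⟩ ∪ ⟨ e ∷ o ∷ o ∷ o ∷ [] ⟩)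
    × (𝒫 {5} ≐ ⟨ e ∷ e ∷ e ∷ e ∷ e ∷ [] ⟩ ∪ ⟨ e ∷ e ∷ o ∷ o ∷ o ∷ [] ⟩
    ∪ ⟨ o ∷ o ∷ e ∷ e ∷ o ∷ [] ⟩ ∪ ⟨ o ∷ o ∷ o ∷ o ∷ e ∷ [] ⟩)
lemma3p1 =
    -- Only the length of the code is given, which lets `⋃` unfold; unification finds the entries.
    -- Both conditions on the code are settled by evaluating their decision procedures.
    𝒫≐⋃ _ (_ ∷ []) (from-yes (separated? C₃)) (from-yes (absorbing? C₃))
  , 𝒫≐⋃ _ (_ ∷ []) (from-yes (separated? C₄)) (from-yes (absorbing? C₄))
  , 𝒫≐⋃ _ (_ ∷ _ ∷ _ ∷ []) (from-yes (separated? C₅)) (from-yes (absorbing? C₅))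
  where
  C₃ = (e ∷ e ∷ e ∷ []) ∷ (o ∷ o ∷ o ∷ []) ∷ []
  C₄ = (e ∷ e ∷ e ∷ e ∷ []) ∷ (e ∷ o ∷ o ∷ o ∷ []) ∷ []
  C₅ = (e ∷ e ∷ e ∷ e ∷ e ∷ []) ∷ (e ∷ e ∷ o ∷ o ∷ o ∷ []) ∷
       (o ∷ o ∷ e ∷ e ∷ o ∷ []) ∷ (o ∷ o ∷ o ∷ o ∷ e ∷ []) ∷ []
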